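{- For every natural number $k\geq 1$, $(\mathfrak{e}^{\mathrm{G}}_k)_{0}=\mathfrak{e}^{\mathrm{G}}_k$.
   Context: Let $Z\subseteq\omega^\omega$ denote the set of all eventually zero functions, i.e. those $f\in\omega^\omega$ with $f(n)=0$ for all but finitely many $n$. Let $\omega^{<\omega}$ be the set of finite sequences of natural numbers and $[\omega]^k$ the set of $k$-element subsets of $\omega$. For a natural number $k\ge 1$, a global predictor of width $k$ is a function $\pi\colon\omega^{<\omega}\to[\omega]^k$. Such a $\pi$ globally predicts $f\in\omega^\omega$ if $f(n)\in\pi(f\upharpoonright n)$ for all but finitely many $n\in\omega$. A global predictor $\pi$ of width $k$ $0$-globally predicts $f\in\omega^\omega$ if either $f\notin Z$ and $\pi$ globally predicts $f$, or $f\in Z$ and $\pi$ does not globally predict $f$. $\mathfrak{e}^{\mathrm{G}}_k$ is the least cardinality of a family $F\subseteq\omega^\omega$ such that no single global predictor of width $k$ globally predicts all members of $F$. $(\mathfrak{e}^{\mathrm{G}}_k)_{0}$ is the least cardinality of a family $F\subseteq\omega^\omega$ such that no single global predictor of width $k$ $0$-globally predicts all members of $F$. -}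

module Defs where

open import Data.List using (List; applyUpTo)
open import Data.Nat using (ℕ; _≥_)
open import Data.Product using (Σ; Σ-syntax; ∃-syntax; _×_; _,_; proj₁)
open import Data.Sum using (_⊎_)
open import Data.Vec using (Vec)
open import Data.Vec.Membership.Propositional using () renaming (_∈_ to _∈ᵛ_)
open import Data.Vec.Relation.Unary.Unique.Propositional using (Unique)
open import Function.Bundles using (Injection; Inverse)
open import Induction.WellFounded using (WellFounded)
open import Level using (0ℓ)
open import Relation.Binary.Bundles using (Setoid)
open import Relation.Binary.Core using (Rel)
open import Relation.Binary.Definitions using (_Respects_)
open import Relation.Binary.Structures using (IsStrictTotalOrder)
import Relation.Binary.Construct.On as On
open import Relation.Binary.PropositionalEquality using (_≡_; _≗_; _→-setoid_)
open import Relation.Nullary using (¬_)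
open import Relation.Unary using (Pred)

-- The axiom of choice, in the form of Zermelo's well-ordering theorem.
-- The order is on the quotient: it is total up to, and respects, the
-- setoid equality.  (Choice phrased with Σ would be provable outright and
-- would say nothing about choosing from equivalence classes.)
WellOrderingPrinciple : Set₁
WellOrderingPrinciple =
  (S : Setoid 0ℓ 0ℓ) → let open Setoid S in
  Σ[ _<_ ∈ Rel Carrier 0ℓ ] (IsStrictTotalOrder _≈_ _<_ × WellFounded _<_)

ω^ω : Set
ω^ω = ℕ → ℕ

-- Equality of functions is pointwise, so a subset of ω^ω is a predicate
-- that respects it, and its cardinality is that of the setoid ⟦ F ⟧.
record Family : Set₁ where
  field
    member : Pred ω^ω 0ℓ
    resp   : member Respects _≗_

open Family public

⟦_⟧ : Family → Setoid 0ℓ 0ℓ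
⟦ F ⟧ = On.setoid {B = Σ ω^ω (member F)} (ℕ →-setoid ℕ) proj₁

infix 4 _∈_
_∈_ : ω^ω → Family → Set
f ∈ F = member F f

ForAlmostAll : Pred ℕ 0ℓ → Set
ForAlmostAll P = ∃[ N ] (∀ n → n ≥ N → P n)

Z : Pred ω^ω 0ℓ
Z f = ForAlmostAll (λ n → f n ≡ 0)

-- A k-element subset of ω is given by a repetition-free enumeration.  Only
-- membership in it is ever used, so the order of enumeration is immaterial.
[ω]^_ : ℕ → Set
[ω]^ k = Σ (Vec ℕ k) Unique

infix 4 _∈ˢ_
_∈ˢ_ : ∀ {k} → ℕ → [ω]^ k → Set
m ∈ˢ (xs , _) = m ∈ᵛ xs

GlobalPredictor : ℕ → Set
GlobalPredictor k = List ℕ → [ω]^ k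

-- f ↾ n = ⟨ f 0 , … , f (n − 1) ⟩
_↾_ : ω^ω → ℕ → List ℕ
f ↾ n = applyUpTo f n

_GloballyPredicts_ : ∀ {k} → GlobalPredictor k → ω^ω → Set
π GloballyPredicts f = ForAlmostAll (λ n → f n ∈ˢ π (f ↾ n))

_0-GloballyPredicts_ : ∀ {k} → GlobalPredictor k → ω^ω → Set
π 0-GloballyPredicts f =
  (¬ Z f × π GloballyPredicts f) ⊎ (Z f × ¬ (π GloballyPredicts f))

Unpredictable : ℕ → Pred Family 0ℓ
Unpredictable k F =
  ¬ (Σ[ π ∈ GlobalPredictor k ] (∀ f → f ∈ F → π GloballyPredicts f))

0-Unpredictable : ℕ → Pred Family 0ℓ
0-Unpredictable k F =
  ¬ (Σ[ π ∈ GlobalPredictor k ] (∀ f → f ∈ F → π 0-GloballyPredicts f))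

-- Cardinals are represented by setoids, up to bijection.  Classically, by
-- Cantor–Bernstein, a least cardinality is unique in this sense.
_IsLeastCardinalityOf_ : Setoid 0ℓ 0ℓ → Pred Family 0ℓ → Set₁
κ IsLeastCardinalityOf P =
  (Σ[ F ∈ Family ] (P F × Inverse κ ⟦ F ⟧)) ×
  (∀ F → P F → Injection κ ⟦ F ⟧)

_Is-𝔢ᴳ_ : Setoid 0ℓ 0ℓ → ℕ → Set₁
κ Is-𝔢ᴳ k = κ IsLeastCardinalityOf Unpredictable k

_Is-𝔢ᴳ₀_ : Setoid 0ℓ 0ℓ → ℕ → Set₁
κ Is-𝔢ᴳ₀ k = κ IsLeastCardinalityOf 0-Unpredictable k

{-# OPTIONS --safe #-}
module Submission where

-- Adding 1 to every value takes a family out of Z without changing whether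
-- it can be predicted, so 𝔢ᴳ₀ ≤ 𝔢ᴳ.  Conversely, write f ∉ Z as a concatenation
-- of words 0ᵃ (1 + v) and predict the sequence g of the codes of the pairs
-- (a , v) instead.  Inside a block, each of the k candidates for the current
-- pair gives at most one candidate for the next value of f, and 0 is no longer
-- proposed once the run of zeros is longer than all k candidate gaps.  Hence
-- no member of Z is predicted, while every f ∉ Z with g predicted is, so that
-- 𝔢ᴳ ≤ 𝔢ᴳ₀.  That the least cardinality exists follows by collapsing each
-- family to an initial segment of a well-order of ω^ω.

open import Defs
open import Axiom.ExcludedMiddle using (ExcludedMiddle)
open import Data.List using (List; []; _∷_; _∷ʳ_)
import Data.List as List
open import Data.List.Properties using (applyUpTo-∷ʳ; map-applyUpTo)
open import Data.Nat
  using (ℕ; zero; suc; pred; _+_; _∸_; _≤_; _<_; _≥_; z≤n; s≤s; s≤s⁻¹)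
open import Data.Nat.Properties
open import Data.Product
  using (Σ; Σ-syntax; ∃; ∃-syntax; _×_; _,_; proj₁; proj₂; map₁)
open import Data.Sum using (_⊎_; inj₁; inj₂)
open import Data.Unit using (⊤)
open import Data.Vec using (Vec; []; _∷_; map; sum)
open import Data.Vec.Membership.DecPropositional _≟_ using (_∈?_)
open import Data.Vec.Membership.Propositional using () renaming (_∈_ to _∈ᵛ_)
open import Data.Vec.Membership.Propositional.Properties using (∈-map⁺)
open import Data.Vec.Relation.Unary.All as All using (All; []; _∷_)
import Data.Vec.Relation.Unary.All.Properties as All
open import Data.Vec.Relation.Unary.AllPairs using ([]; _∷_)
open import Data.Vec.Relation.Unary.Any using (here; there)
open import Function using (_∘_; id)
open import Function.Bundles using (Injection; Inverse)
import Function.Construct.Composition as Composition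
import Function.Construct.Identity as Identity
open import Induction.WellFounded using (Acc; acc; WellFounded)
open import Level using (0ℓ; Lift; lift; lower) renaming (suc to ℓsuc)
open import Relation.Binary.Bundles using (Setoid)
import Relation.Binary.Construct.On as On
open import Relation.Binary.Core using (Rel)
open import Relation.Binary.Definitions using (tri<; tri≈; tri>)
open import Relation.Binary.PropositionalEquality
  using (_≡_; _≢_; _≗_; refl; sym; trans; cong; cong₂; subst; subst₂; _→-setoid_)
open import Relation.Binary.Structures using (IsStrictTotalOrder)
open import Relation.Nullary using (¬_; yes; no; contradiction)
open import Relation.Nullary.Decidable using (map′; decidable-stable)
open import Relation.Unary using (Pred)

lowerEM : ExcludedMiddle (ℓsuc 0ℓ) → ExcludedMiddle 0ℓ
lowerEM em {P} = map′ lower lift (em {Lift (ℓsuc 0ℓ) P})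

-- Collapsing a map into a well-order.

module WellOrdered
  (em : ExcludedMiddle (ℓsuc 0ℓ)) (S : Setoid 0ℓ 0ℓ) {_≺_ : Rel (Setoid.Carrier S) 0ℓ}
  (isSTO : IsStrictTotalOrder (Setoid._≈_ S) _≺_) (wf : WellFounded _≺_)
  where

  open Setoid S using (Carrier; _≈_)
  module ≈ = Setoid S
  open IsStrictTotalOrder isSTO using (compare; <-respʳ-≈)

  em₀ : ExcludedMiddle 0ℓ
  em₀ = lowerEM em

  least : ∀ {ℓ} → ExcludedMiddle ℓ → {P : Pred Carrier ℓ} → ∃ P →
          ∃[ m ] (P m × (∀ {y} → y ≺ m → ¬ P y))
  least em′ {P} (x , Px) = go x (wf x) Px
    where
    go : ∀ x → Acc _≺_ x → P x → ∃[ m ] (P m × (∀ {y} → y ≺ m → ¬ P y))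
    go x (acc rs) Px with em′ {∃[ y ] (y ≺ x × P y)}
    ... | yes (y , y≺x , Py) = go y (rs y≺x) Py
    ... | no none = x , Px , λ y≺x Py → none (_ , y≺x , Py)

  module Collapse {A : Set} (ι : A → Carrier) where

    -- The Mostowski collapse, with values in S itself instead of the
    -- ordinals: rank a is the least point that is not the rank of an
    -- element below a.  The second component shows rank a ≼ ι a, so that
    -- ι a is always available and the recursion does not run out of points.
    rankBelow : ∀ a → Acc _≺_ (ι a) → ∃[ y ] ¬ (ι a ≺ y)

    Free : ∀ a → (∀ {y} → y ≺ ι a → Acc _≺_ y) → Pred Carrier 0ℓ
    Free a rs y = ∀ b (b≺a : ι b ≺ ι a) → ¬ (y ≈ proj₁ (rankBelow b (rs b≺a)))

    leastFree : ∀ a (rs : ∀ {y} → y ≺ ι a → Acc _≺_ y) →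
                ∃[ m ] (Free a rs m × (∀ {y} → y ≺ m → ¬ Free a rs y))

    ι-free : ∀ a (rs : ∀ {y} → y ≺ ι a → Acc _≺_ y) → Free a rs (ι a)
    ι-free a rs b b≺a a≈rb = proj₂ (rankBelow b (rs b≺a)) (<-respʳ-≈ a≈rb b≺a)

    leastFree a rs = least em₀ (ι a , ι-free a rs)

    rankBelow a (acc rs) =
      let m , _ , minimal = leastFree a rs
      in  m , λ a≺m → minimal a≺m (ι-free a rs)

    rank′ : ∀ a → Acc _≺_ (ι a) → Carrier
    rank′ a p = proj₁ (rankBelow a p)

    below-rank′ : ∀ a (rs : ∀ {y} → y ≺ ι a → Acc _≺_ y) {y} → y ≺ rank′ a (acc rs) →
                  ∃[ b ] Σ[ b≺a ∈ ι b ≺ ι a ] y ≈ rank′ b (rs b≺a)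
    below-rank′ a rs y≺ = decidable-stable em₀ λ none →
      proj₂ (proj₂ (leastFree a rs)) y≺ λ b b≺a y≈ → none (b , b≺a , y≈)

    rank′-≉ : ∀ a (rs : ∀ {y} → y ≺ ι a → Acc _≺_ y) → Free a rs (rank′ a (acc rs))
    rank′-≉ a rs = proj₁ (proj₂ (leastFree a rs))

    mutual
      -- A smaller rank would, by minimality, be the rank of some `c` below `b`, hence below `a`,
      -- which freeness of the rank of `a` excludes. The mutual pair also makes ranks independent of
      -- the accessibility proof.
      rank′-⊀ : ∀ a b p q → ι a ≈ ι b → ¬ (rank′ a p ≺ rank′ b q)
      rank′-⊀ a b (acc rs) (acc ss) a≈b lt =
        let c , c≺b , ra≈rc = below-rank′ b ss lt
            c≺a = <-respʳ-≈ (≈.sym a≈b) c≺b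
        in  rank′-≉ a rs c c≺a (≈.trans ra≈rc (rank′-cong c c (ss c≺b) (rs c≺a) ≈.refl))

      rank′-cong : ∀ a b p q → ι a ≈ ι b → rank′ a p ≈ rank′ b q
      rank′-cong a b p q a≈b with compare (rank′ a p) (rank′ b q)
      ... | tri< lt _ _ = contradiction lt (rank′-⊀ a b p q a≈b)
      ... | tri≈ _ eq _ = eq
      ... | tri> _ _ gt = contradiction gt (rank′-⊀ b a q p (≈.sym a≈b))

    rank : A → Carrier
    rank a = rank′ a (wf (ι a))

    rank-cong : ∀ {a b} → ι a ≈ ι b → rank a ≈ rank b
    rank-cong {a} {b} = rank′-cong a b (wf (ι a)) (wf (ι b))

    rank′≈rank : ∀ a p → rank′ a p ≈ rank a
    rank′≈rank a p = rank′-cong a a p (wf (ι a)) ≈.refl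

    rank-≉ : ∀ {a b} → ι b ≺ ι a → ¬ (rank a ≈ rank b)
    rank-≉ {a} {b} b≺a ra≈rb = go (wf (ι a)) ra≈rb
      where
      -- `rank′` unfolds only on `acc`, so `wf (ι a)` is generalised before matching.
      go : ∀ p → ¬ (rank′ a p ≈ rank b)
      go (acc rs) eq = rank′-≉ a rs b b≺a (≈.trans eq (≈.sym (rank′≈rank b (rs b≺a))))

    rank-injective : ∀ {a b} → rank a ≈ rank b → ι a ≈ ι b
    rank-injective {a} {b} eq with compare (ι a) (ι b)
    ... | tri< a≺b _ _ = contradiction (≈.sym eq) (rank-≉ a≺b)
    ... | tri≈ _ a≈b _ = a≈b
    ... | tri> _ _ b≺a = contradiction eq (rank-≉ b≺a)

    Hit : Pred Carrier 0ℓ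
    Hit y = ∃[ a ] y ≈ rank a

    below-rank : ∀ {a y} → y ≺ rank a → Hit y
    below-rank {a} {y} = go (wf (ι a))
      where
      go : ∀ p → y ≺ rank′ a p → Hit y
      go (acc rs) y≺ =
        let b , b≺a , y≈ = below-rank′ a rs y≺
        in  b , ≈.trans y≈ (rank′≈rank b (rs b≺a))

    -- The range is downward closed by `below-rank`, so the least missed point, if any, bounds it
    -- strictly.
    range-initial : (∀ y → Hit y) ⊎
                    (∃[ x ] ((∀ a → rank a ≺ x) × (∀ {y} → y ≺ x → Hit y)))
    range-initial with em₀ {∃[ x ] ¬ Hit x}
    ... | no none = inj₁ λ y → decidable-stable em₀ λ ¬hit → none (y , ¬hit)
    ... | yes missed with least em₀ missed
    ... | x , ¬hit , minimal = inj₂ (x , bounded , λ y≺x → decidable-stable em₀ (minimal y≺x))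
      where
      bounded : ∀ a → rank a ≺ x
      bounded a with compare (rank a) x
      ... | tri< lt _ _ = lt
      ... | tri≈ _ eq _ = contradiction (a , ≈.sym eq) ¬hit
      ... | tri> _ _ gt = contradiction (below-rank gt) ¬hit

    rankInjection : Injection (On.setoid S ι) S
    rankInjection = record { to = rank ; cong = rank-cong ; injective = rank-injective }

    -- `h` followed by the inverse of `rank`, with preimages supplied by `hit`.
    factor : ∀ {D : Setoid 0ℓ 0ℓ} (h : Injection D S) → (∀ d → Hit (Injection.to h d)) →
             Injection D (On.setoid S ι)
    factor h hit = record
      { to        = proj₁ ∘ hit
      ; cong      = λ {d} {e} d≈e → rank-injective
          (≈.trans (≈.sym (proj₂ (hit d))) (≈.trans (Injection.cong h d≈e) (proj₂ (hit e))))
      ; injective = λ {d} {e} eq → Injection.injective h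
          (≈.trans (proj₂ (hit d)) (≈.trans (rank-cong eq) (≈.sym (proj₂ (hit e)))))
      }

-- Existence of a least cardinality.

module _ (em : ExcludedMiddle (ℓsuc 0ℓ)) (wo : WellOrderingPrinciple) where

  open Setoid (ℕ →-setoid ℕ) using (_≈_)

  _≺_ : Rel ω^ω 0ℓ
  _≺_ = proj₁ (wo (ℕ →-setoid ℕ))

  isSTO : IsStrictTotalOrder _≈_ _≺_
  isSTO = proj₁ (proj₂ (wo (ℕ →-setoid ℕ)))

  open IsStrictTotalOrder isSTO using (compare; <-respʳ-≈) renaming (trans to ≺-trans)
  open WellOrdered em (ℕ →-setoid ℕ) isSTO (proj₂ (proj₂ (wo (ℕ →-setoid ℕ))))

  -- If some point strictly bounds an injective image of a family in `P`, a family attaining the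
  -- least such bound embeds in all others. If no point does, every collapse is onto `ω^ω` and any
  -- family will do.
  leastCardinality : (P : Pred Family 0ℓ) → ∃ P →
                     Σ[ F ∈ Family ] (P F × (∀ G → P G → Injection ⟦ F ⟧ ⟦ G ⟧))
  leastCardinality P (F₁ , PF₁) with em {∃ Bounding}
    where
    Bounding : Pred ω^ω (ℓsuc 0ℓ)
    Bounding x = Σ[ F ∈ Family ] (P F ×
      (Σ[ h ∈ Injection ⟦ F ⟧ (ℕ →-setoid ℕ) ] (∀ f → Injection.to h f ≺ x)))
  ... | no unbounded = F₁ , PF₁ , embed
    where
    inclusion : Injection ⟦ F₁ ⟧ (ℕ →-setoid ℕ)
    inclusion = record { to = proj₁ ; cong = id ; injective = id }

    embed : ∀ G → P G → Injection ⟦ F₁ ⟧ ⟦ G ⟧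
    embed G PG with Collapse.range-initial {Σ ω^ω (member G)} proj₁
    ... | inj₁ onto = Collapse.factor proj₁ inclusion (onto ∘ proj₁)
    ... | inj₂ (x , bounded , _) =
      contradiction (x , G , PG , Collapse.rankInjection proj₁ , bounded) unbounded
  ... | yes bounding with least em bounding
  ... | x , (F , PF , h , h≺x) , minimal = F , PF , embed
    where
    embed : ∀ G → P G → Injection ⟦ F ⟧ ⟦ G ⟧
    embed G PG with Collapse.range-initial {Σ ω^ω (member G)} proj₁
    ... | inj₁ onto = Collapse.factor proj₁ h (onto ∘ Injection.to h)
    ... | inj₂ (y , bounded , hit) = Collapse.factor proj₁ h λ f → hit (h≺y f)
      where
      h≺y : ∀ f → Injection.to h f ≺ y
      h≺y f with compare x y
      ... | tri< x≺y _ _ = ≺-trans (h≺x f) x≺y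
      ... | tri≈ _ x≈y _ = <-respʳ-≈ x≈y (h≺x f)
      ... | tri> _ _ y≺x =
        contradiction (G , PG , Collapse.rankInjection proj₁ , bounded) (minimal y≺x)

-- Sets of exactly k elements.

≤sum : ∀ {n} (xs : Vec ℕ n) → All (_≤ sum xs) xs
≤sum []       = []
≤sum (x ∷ xs) = m≤m+n x (sum xs) ∷ All.map (λ y≤ → ≤-trans y≤ (m≤n+m (sum xs) x)) (≤sum xs)

fresh : ∀ {n} → Vec ℕ n → ℕ
fresh xs = suc (sum xs)

fresh-≢ : ∀ {n} (xs : Vec ℕ n) → All (fresh xs ≢_) xs
fresh-≢ xs = All.map (λ x≤ → >⇒≢ (s≤s x≤)) (≤sum xs)

∉⇒All≢ : ∀ {n x} (xs : Vec ℕ n) → ¬ (x ∈ᵛ xs) → All (x ≢_) xs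
∉⇒All≢ []       _   = []
∉⇒All≢ (y ∷ xs) x∉ = x∉ ∘ here ∷ ∉⇒All≢ xs (x∉ ∘ there)

-- Each repeated entry gives way to a fresh one, which preserves the length; fresh entries are
-- successors, so 0 is never introduced.
removeRepeats : ∀ {k} (xs : Vec ℕ k) →
  Σ[ ys ∈ [ω]^ k ] ((∀ {x} → x ∈ᵛ xs → x ∈ˢ ys) × (¬ (0 ∈ᵛ xs) → ¬ (0 ∈ˢ ys)))
removeRepeats [] = ([] , []) , id , id
removeRepeats (x ∷ xs) with removeRepeats xs
... | (ys , unique) , ⊇ , 0∉ with x ∈? ys
...   | yes x∈ys = (fresh ys ∷ ys , fresh-≢ ys ∷ unique)
                 , (λ { (here refl) → there x∈ys ; (there y∈) → there (⊇ y∈) })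
                 , λ { 0∉x∷xs (there 0∈) → 0∉ (0∉x∷xs ∘ there) 0∈ }
...   | no  x∉ys = (x ∷ ys , ∉⇒All≢ ys x∉ys ∷ unique)
                 , (λ { (here eq) → here eq ; (there y∈) → there (⊇ y∈) })
                 , λ { 0∉x∷xs (here eq)  → 0∉x∷xs (here eq)
                     ; 0∉x∷xs (there 0∈) → 0∉ (0∉x∷xs ∘ there) 0∈ }

distinct : ∀ {k} → Vec ℕ k → [ω]^ k
distinct xs = proj₁ (removeRepeats xs)

∈-distinct : ∀ {k x} (xs : Vec ℕ k) → x ∈ᵛ xs → x ∈ˢ distinct xs
∈-distinct xs = proj₁ (proj₂ (removeRepeats xs))

0∉-distinct : ∀ {k} (xs : Vec ℕ k) → ¬ (0 ∈ᵛ xs) → ¬ (0 ∈ˢ distinct xs)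
0∉-distinct xs = proj₂ (proj₂ (removeRepeats xs))

-- Extensionality and an unpredictable family.

↾-cong : ∀ {f g} → f ≗ g → ∀ n → f ↾ n ≡ g ↾ n
↾-cong f≗g zero    = refl
↾-cong f≗g (suc n) = cong₂ _∷_ (f≗g 0) (↾-cong (f≗g ∘ suc) n)

GloballyPredicts-resp : ∀ {k} (π : GlobalPredictor k) {f g} → f ≗ g →
                        π GloballyPredicts f → π GloballyPredicts g
GloballyPredicts-resp π f≗g (N , p) =
  N , λ n n≥N → subst₂ (λ x s → x ∈ˢ π s) (f≗g n) (↾-cong f≗g n) (p n n≥N)

everything : Family
everything = record { member = λ _ → ⊤ ; resp = λ _ _ → _ }

-- Diagonalisation: at every position the evader takes a value that `π` does not propose.
everything-unpredictable : ∀ k → Unpredictable k everything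
everything-unpredictable k (π , predicts) =
  let N , p = predicts evader _
  in  All.lookup (fresh-≢ (proj₁ (π (evader ↾ N)))) (p N ≤-refl) (evades N)
  where
  -- Building the initial segments first makes the recursion structural.
  history : ℕ → List ℕ
  history zero    = []
  history (suc n) = history n ∷ʳ fresh (proj₁ (π (history n)))

  evader : ω^ω
  evader n = fresh (proj₁ (π (history n)))

  evader-↾ : ∀ n → evader ↾ n ≡ history n
  evader-↾ zero    = refl
  evader-↾ (suc n) =
    trans (sym (applyUpTo-∷ʳ evader n)) (cong (_∷ʳ evader n) (evader-↾ n))

  evades : ∀ n → fresh (proj₁ (π (evader ↾ n))) ≡ evader n
  evades n = cong (fresh ∘ proj₁ ∘ π) (evader-↾ n)

-- Shifting a family out of Z.

shifted : Family → Family
shifted F = record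
  { member = λ g → ∃[ f ] (f ∈ F × g ≗ suc ∘ f)
  ; resp   = λ { g≗h (f , f∈F , g≗) → f , f∈F , λ n → trans (sym (g≗h n)) (g≗ n) }
  }

shifted-↔ : ∀ F → Inverse ⟦ F ⟧ ⟦ shifted F ⟧
shifted-↔ F = record
  { to        = λ { (f , f∈F) → suc ∘ f , f , f∈F , λ _ → refl }
  ; from      = λ { (_ , f , f∈F , _) → f , f∈F }
  ; to-cong   = λ f≗g n → cong suc (f≗g n)
  ; from-cong = λ { {_ , _ , _ , g≗} {_ , _ , _ , h≗} g≗h n →
      suc-injective (trans (sym (g≗ n)) (trans (g≗h n) (h≗ n))) }
  ; inverse   = (λ { {_ , _ , _ , g≗} f≗ n → trans (cong suc (f≗ n)) (sym (g≗ n)) })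
              , (λ { {_} {_ , _ , _ , g≗} g≗f n → suc-injective (trans (sym (g≗ n)) (g≗f n)) })
  }

-- Shifted functions never vanish, so 0-prediction of them is ordinary prediction, which `π⁻` pulls
-- back along the shift.
shifted-0-unpredictable : ∀ {k} F → Unpredictable k F → 0-Unpredictable k (shifted F)
shifted-0-unpredictable {k} F unpredictable (π , predicts) = unpredictable (π⁻ , π⁻-predicts)
  where
  π⁻ : GlobalPredictor k
  -- `pred` merges 0 and 1, so `distinct` has to restore k different values.
  π⁻ s = distinct (map pred (proj₁ (π (List.map suc s))))

  π⁻-predicts : ∀ f → f ∈ F → π⁻ GloballyPredicts f
  π⁻-predicts f f∈F with predicts (suc ∘ f) (f , f∈F , λ _ → refl)
  ... | inj₂ ((N , vanishes) , _) = contradiction (vanishes N ≤-refl) λ ()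
  ... | inj₁ (_ , N , p) = N , λ n n≥N → ∈-distinct _ (∈-map⁺ pred
    (subst (λ s → suc (f n) ∈ˢ π s) (sym (map-applyUpTo f suc n)) (p n n≥N)))

-- Coding functions outside Z by sequences of pairs.

-- Cantor's enumeration of ℕ × ℕ along the antidiagonals.
next : ℕ × ℕ → ℕ × ℕ
next (zero  , b) = suc b , 0
next (suc a , b) = a , suc b

unpair : ℕ → ℕ × ℕ
unpair zero    = 0 , 0
unpair (suc n) = next (unpair n)

next-injective : ∀ {p q} → next p ≡ next q → p ≡ q
next-injective {zero  , _} {zero  , _} refl = refl
next-injective {suc _ , _} {suc _ , _} refl = refl

next-≢ : ∀ {p} → next p ≢ (0 , 0)
next-≢ {zero  , _} ()
next-≢ {suc _ , _} ()

unpair-injective : ∀ m n → unpair m ≡ unpair n → m ≡ n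
unpair-injective zero    zero    _  = refl
unpair-injective zero    (suc n) eq = contradiction (sym eq) next-≢
unpair-injective (suc m) zero    eq = contradiction eq next-≢
unpair-injective (suc m) (suc n) eq = cong suc (unpair-injective m n (next-injective eq))

unpair-surjective : ∀ p → ∃[ n ] unpair n ≡ p
unpair-surjective (a , b) = antidiagonal (a + b) a b refl
  where
  -- The recursion runs `next` backwards: along the antidiagonal, then to the last point of the
  -- previous one.
  antidiagonal : ∀ d a b → a + b ≡ d → ∃[ n ] unpair n ≡ (a , b)
  antidiagonal d       a       (suc b) eq =
    let n , e = antidiagonal d (suc a) b (trans (sym (+-suc a b)) eq) in suc n , cong next e
  antidiagonal (suc d) (suc a) zero    eq =
    let n , e = antidiagonal d 0 a (trans (sym (+-identityʳ a)) (suc-injective eq))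
    in  suc n , cong next e
  antidiagonal zero    zero    zero    _  = 0 , refl

pair : ℕ × ℕ → ℕ
pair p = proj₁ (unpair-surjective p)

unpair-pair : ∀ p → unpair (pair p) ≡ p
unpair-pair p = proj₂ (unpair-surjective p)

pair-unpair : ∀ n → pair (unpair n) ≡ n
pair-unpair n = unpair-injective _ _ (unpair-pair (unpair n))

-- blocks (a , v) g is the concatenation of the words 0ᵃ (1 + v) for (a , v)
-- and then for the pairs coded by g 0 , g 1 , …
blocks : ℕ × ℕ → ω^ω → ω^ω
blocks (zero  , v) g zero    = suc v
blocks (zero  , v) g (suc n) = blocks (unpair (g 0)) (g ∘ suc) n
blocks (suc a , v) g zero    = 0
blocks (suc a , v) g (suc n) = blocks (a , v) g n

decode : ω^ω → ω^ω
decode g = blocks (unpair (g 0)) (g ∘ suc)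

blocks-cong : ∀ p {g h} → g ≗ h → blocks p g ≗ blocks p h
blocks-cong (zero  , v) g≗h zero    = refl
blocks-cong (zero  , v) {g} {h} g≗h (suc n) rewrite g≗h 0 =
  blocks-cong (unpair (h 0)) (g≗h ∘ suc) n
blocks-cong (suc a , v) g≗h zero    = refl
blocks-cong (suc a , v) g≗h (suc n) = blocks-cong (a , v) g≗h n

decode-cong : ∀ {g h} → g ≗ h → decode g ≗ decode h
decode-cong {g} {h} g≗h n rewrite g≗h 0 = blocks-cong (unpair (h 0)) (g≗h ∘ suc) n

-- The words form a prefix code: the leading zeros give `a`, the first nonzero value gives `v`.
blocks-injective : ∀ p q {g h} → blocks p g ≗ blocks q h → p ≡ q × decode g ≗ decode h
blocks-injective (zero  , v) (zero  , w) eq = cong (0 ,_) (suc-injective (eq 0)) , eq ∘ suc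
blocks-injective (zero  , v) (suc b , w) eq = contradiction (eq 0) λ ()
blocks-injective (suc a , v) (zero  , w) eq = contradiction (eq 0) λ ()
blocks-injective (suc a , v) (suc b , w) eq =
  let p≡q , rest = blocks-injective (a , v) (b , w) (eq ∘ suc)
  in  cong (λ { (a , v) → suc a , v }) p≡q , rest

decode-injective : ∀ g h → decode g ≗ decode h → g ≗ h
decode-injective g h eq n with blocks-injective (unpair (g 0)) (unpair (h 0)) eq
decode-injective g h eq zero    | p≡q , _    = unpair-injective _ _ p≡q
decode-injective g h eq (suc n) | _   , rest = decode-injective (g ∘ suc) (h ∘ suc) rest n

data StartsWith : ℕ × ℕ → ω^ω → Set where
  now   : ∀ {v f} → f 0 ≡ suc v → StartsWith (0 , v) f
  later : ∀ {a v f} → f 0 ≡ 0 → StartsWith (a , v) (f ∘ suc) → StartsWith (suc a , v) f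

-- The known nonzero position `j` bounds the search.
firstBlock : ∀ f j → f j ≢ 0 → ∃[ p ] StartsWith p f
firstBlock f j fj≢0 with f 0 in eq
... | suc v = (0 , v) , now eq
firstBlock f zero    fj≢0 | zero = contradiction eq fj≢0
firstBlock f (suc j) fj≢0 | zero =
  let (a , v) , s = firstBlock (f ∘ suc) j fj≢0 in (suc a , v) , later eq s

afterBlock : ∀ {p f} → StartsWith p f → ω^ω
afterBlock {f = f} (now _) = f ∘ suc
afterBlock (later _ s)     = afterBlock s

InfinitelyOftenNonzero : Pred ω^ω 0ℓ
InfinitelyOftenNonzero f = ∀ N → ∃[ j ] f (N + j) ≢ 0

afterBlock-nonzero : ∀ {p f} (s : StartsWith p f) →
                     InfinitelyOftenNonzero f → InfinitelyOftenNonzero (afterBlock s)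
afterBlock-nonzero (now _)     io = io ∘ suc
afterBlock-nonzero (later _ s) io = afterBlock-nonzero s (io ∘ suc)

encode : ∀ f → InfinitelyOftenNonzero f → ω^ω
encode f io n with firstBlock f (proj₁ (io 0)) (proj₂ (io 0))
encode f io zero    | p , _ = pair p
encode f io (suc n) | _ , s = encode (afterBlock s) (afterBlock-nonzero s io) n

decode-encode : ∀ f io → decode (encode f io) ≗ f
blocks-encode : ∀ {p f} (s : StartsWith p f) (io : InfinitelyOftenNonzero (afterBlock s)) →
                blocks p (encode (afterBlock s) io) ≗ f
decode-encode f io n with firstBlock f (proj₁ (io 0)) (proj₂ (io 0))
... | p , s rewrite unpair-pair p = blocks-encode s (afterBlock-nonzero s io) n
blocks-encode (now e)     io zero    = sym e
blocks-encode {f = f} (now _) io (suc n) = decode-encode (f ∘ suc) io n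
blocks-encode (later e _) io zero    = sym e
blocks-encode (later _ s) io (suc n) = blocks-encode s io n

-- Parsing initial segments into blocks.

-- parse j splits 0ʲ followed by the word s into complete blocks, whose codes
-- it returns, and a remaining run of zeros, whose length it returns.
parse : ℕ → List ℕ → List ℕ × ℕ
parse j []          = [] , j
parse j (zero  ∷ s) = parse (suc j) s
parse j (suc v ∷ s) = map₁ (pair (j , v) ∷_) (parse 0 s)

-- The entry at position j of the word 0ᵃ (1 + v).  Beyond the end of the
-- word the value is 1: what matters is that it is not 0.
entry : ℕ × ℕ → ℕ → ℕ
entry (zero  , v) zero    = suc v
entry (zero  , v) (suc j) = 1
entry (suc a , v) zero    = 0
entry (suc a , v) (suc j) = entry (a , v) j

entry-0 : ∀ p j → entry p j ≡ 0 → j < proj₁ p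
entry-0 (suc a , v) zero    _  = s≤s z≤n
entry-0 (suc a , v) (suc j) eq = s≤s (entry-0 (a , v) j eq)
entry-0 (zero  , v) zero    ()
entry-0 (zero  , v) (suc j) ()

entry-blocks : ∀ j a v g → entry (j + a , v) j ≡ blocks (a , v) g 0
entry-blocks zero    zero    v g = refl
entry-blocks zero    (suc a) v g = refl
entry-blocks (suc j) a       v g = entry-blocks j a v g

-- The position in blocks p (h ∘ suc) where the N-th block begins.
blockStart : ℕ → ℕ → ω^ω → ℕ
blockStart zero    a h = 0
blockStart (suc N) a h = a + suc (blockStart N (proj₁ (unpair (h 1))) (h ∘ suc))

-- Here the first block of h is 0ʲ⁺ᵃ (1 + v), of which 0ʲ has been read before
-- f = blocks (a , v) (h ∘ suc) starts.
locate : ∀ n {j a v} h → unpair (h 0) ≡ (j + a , v) →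
  let f = blocks (a , v) (h ∘ suc) in
  ∃[ i ] ∃[ l ] (parse j (f ↾ n) ≡ (h ↾ i , l)
               × entry (unpair (h i)) l ≡ f n
               × (∀ N → blockStart N a h ≤ n → N ≤ i))
locate zero {j} {a} {v} h eq =
  0 , j , refl , trans (cong (λ p → entry p j) eq) (entry-blocks j a v (h ∘ suc)) , started
  where
  started : ∀ N → blockStart N a h ≤ 0 → N ≤ 0
  started zero    _ = z≤n
  started (suc N) ≤0 = contradiction (≤-trans (m≤n+m _ a) ≤0) λ ()
locate (suc n) {j} {suc a} {v} h eq =
  -- Reading a zero moves one unit from `a` to `j`; the gap `j + a` is unchanged.
  let i , l , parsed , entry≡ , started = locate n h (trans eq (cong (_, v) (+-suc j a)))
  in  i , l , parsed , entry≡ , λ where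
        zero    _  → z≤n
        (suc N) ≤n → started (suc N) (s≤s⁻¹ ≤n)
locate (suc n) {j} {zero} {v} h eq =
  -- A nonzero value closes the block, so parsing restarts with no zeros read.
  let i , l , parsed , entry≡ , started = locate n (h ∘ suc) refl
  in  suc i , l
    , cong₂ (λ x → map₁ (x ∷_)) code≡ parsed
    , entry≡
    , λ where
        zero    _  → z≤n
        (suc N) ≤n → s≤s (started N (s≤s⁻¹ ≤n))
  where
  code≡ : pair (j , v) ≡ h 0
  code≡ = trans (cong pair (trans (cong (_, v) (sym (+-identityʳ j))) (sym eq))) (pair-unpair (h 0))

-- Once only zeros follow, no further block is completed: the list of codes freezes and the run
-- grows.
parse-zeros : ∀ N j f → (∀ n → n ≥ N → f n ≡ 0) →
              ∃[ s ] ∃[ l ] (∀ m → parse j (f ↾ (N + m)) ≡ (s , l + m))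
parse-zeros zero j f vanishes = [] , j , λ m → run j m f (λ n → vanishes n z≤n)
  where
  run : ∀ j m f → (∀ n → f n ≡ 0) → parse j (f ↾ m) ≡ ([] , j + m)
  run j zero    f f≡0 = cong ([] ,_) (sym (+-identityʳ j))
  run j (suc m) f f≡0 rewrite f≡0 0 =
    trans (run (suc j) m (f ∘ suc) (f≡0 ∘ suc)) (cong ([] ,_) (sym (+-suc j m)))
parse-zeros (suc N) j f vanishes with f 0
... | zero  = parse-zeros N (suc j) (f ∘ suc) λ n n≥N → vanishes (suc n) (s≤s n≥N)
... | suc v =
  let s , l , parsed = parse-zeros N 0 (f ∘ suc) λ n n≥N → vanishes (suc n) (s≤s n≥N)
  in  pair (j , v) ∷ s , l , λ m → cong (map₁ (pair (j , v) ∷_)) (parsed m)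

-- The blockwise predictor.

entries : ∀ {k} → GlobalPredictor k → List ℕ × ℕ → Vec ℕ k
entries π (s , l) = map (λ x → entry (unpair x) l) (proj₁ (π s))

blockwise : ∀ {k} → GlobalPredictor k → GlobalPredictor k
blockwise π s = distinct (entries π (parse 0 s))

-- From the start of block `N` on, the code of the current block is among the candidates of `π`, and
-- its entry is the true value.
blockwise-predicts : ∀ {k} (π : GlobalPredictor k) g →
                     π GloballyPredicts g → blockwise π GloballyPredicts decode g
blockwise-predicts π g (N , p) = blockStart N (proj₁ (unpair (g 0))) g , predicted
  where
  predicted : ∀ n → n ≥ blockStart N (proj₁ (unpair (g 0))) g →
              decode g n ∈ˢ blockwise π (decode g ↾ n)
  predicted n n≥ with locate n {0} g refl
  ... | i , l , parsed , entry≡ , started =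
    ∈-distinct (entries π (parse 0 (decode g ↾ n)))
      (subst₂ (λ x q → x ∈ᵛ entries π q) entry≡ (sym parsed)
        (∈-map⁺ (λ x → entry (unpair x) l) (p i (started N n≥))))

blockwise-¬predicts : ∀ {k} (π : GlobalPredictor k) f → Z f →
                      ¬ (blockwise π GloballyPredicts f)
blockwise-¬predicts π f (N , vanishes) (M , p)
  with parse-zeros (N + M) 0 f (λ n n≥ → vanishes n (≤-trans (m≤m+n N M) n≥))
... | s , l , parsed =
  0∉-distinct _ 0∉entries
    (subst₂ (λ x q → x ∈ˢ distinct (entries π q)) (vanishes n n≥N) (parsed m) (p n n≥M))
  where
  gaps : Vec ℕ _
  gaps = map (proj₁ ∘ unpair) (proj₁ (π s))

  m n : ℕ
  -- The sum bounds all candidate gaps at once, so a run of `l + m` zeros outlasts each of them.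
  m = sum gaps
  n = N + M + m

  n≥N : n ≥ N
  n≥N = ≤-trans (m≤m+n N M) (m≤m+n (N + M) m)

  n≥M : n ≥ M
  n≥M = ≤-trans (m≤n+m M N) (m≤m+n (N + M) m)

  nonzero : All (λ x → 0 ≢ entry (unpair x) (l + m)) (proj₁ (π s))
  nonzero = All.map (λ {x} gap≤ 0≡ → <-irrefl refl
    (<-≤-trans (entry-0 (unpair x) (l + m) (sym 0≡)) (≤-trans gap≤ (m≤n+m m l))))
    (All.map⁻ (≤sum gaps))

  0∉entries : ¬ (0 ∈ᵛ entries π (s , l + m))
  0∉entries 0∈ = All.lookup (All.map⁺ {P = 0 ≢_} nonzero) 0∈ refl

-- Transfer of families along the coding.

-- A preimage under `decode`, not an image under `encode`, so no proofs of `InfinitelyOftenNonzero`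
-- are carried along.
encoded : Family → Family
encoded F = record
  { member = λ g → decode g ∈ F
  ; resp   = λ g≗h → resp F (decode-cong g≗h)
  }

encoded-↣ : ∀ F → Injection ⟦ encoded F ⟧ ⟦ F ⟧
encoded-↣ F = record
  { to        = λ { (g , g∈) → decode g , g∈ }
  ; cong      = decode-cong
  ; injective = λ { {g , _} {h , _} → decode-injective g h }
  }

¬Z⇒nonzero : ExcludedMiddle 0ℓ → ∀ {f} → ¬ Z f → InfinitelyOftenNonzero f
¬Z⇒nonzero em {f} ¬Zf N = decidable-stable em λ none →
  ¬Zf (N , λ n n≥N → decidable-stable em λ fn≢0 →
    none (n ∸ N , subst (λ i → f i ≢ 0) (sym (m+[n∸m]≡n n≥N)) fn≢0))

-- `blockwise π` fails on all of Z, as required there; any other member of `F` is `decode g` for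
-- some `g` that `π` predicts.
encoded-unpredictable : ExcludedMiddle 0ℓ → ∀ {k} F →
                        0-Unpredictable k F → Unpredictable k (encoded F)
encoded-unpredictable em F unpredictable (π , predicts) =
  unpredictable (blockwise π , blockwise-0-predicts)
  where
  blockwise-0-predicts : ∀ f → f ∈ F → blockwise π 0-GloballyPredicts f
  blockwise-0-predicts f f∈F with em {Z f}
  ... | yes Zf = inj₂ (Zf , blockwise-¬predicts π f Zf)
  ... | no ¬Zf = inj₁ (¬Zf , GloballyPredicts-resp (blockwise π) decoded
                   (blockwise-predicts π g (predicts g (resp F (sym ∘ decoded) f∈F))))
    where
    g : ω^ω
    g = encode f (¬Z⇒nonzero em ¬Zf)

    decoded : decode g ≗ f
    decoded = decode-encode f (¬Z⇒nonzero em ¬Zf)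

theorem2 : ExcludedMiddle (ℓsuc 0ℓ) → WellOrderingPrinciple →
    (k : ℕ) → k ≥ 1 →
    Σ[ κ ∈ Setoid 0ℓ 0ℓ ] (κ Is-𝔢ᴳ₀ k × κ Is-𝔢ᴳ k)
theorem2 em wo k _
  with F , unpredictable , embed ←
         leastCardinality em wo (Unpredictable k) (everything , everything-unpredictable k)
  = ⟦ F ⟧
  -- The shift realises the same cardinal for 0-prediction; minimality passes through `encoded G`.
  , ( (shifted F , shifted-0-unpredictable F unpredictable , shifted-↔ F)
    , λ G 0-unpredictable → Composition.injection
        (embed (encoded G) (encoded-unpredictable (lowerEM em) G 0-unpredictable))
        (encoded-↣ G))
  , ( (F , unpredictable , Identity.inverse ⟦ F ⟧)
    , embed)
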